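{- Let $n \ge 1$ and let $Z$ be any finite binary string (the key, or seed). Write $EM_n(Z) = x_1x_2x_3\dots$. Then there is an $N \ge 0$ such that the string $X = x_{N+1}x_{N+2}\cdots x_{N+2^{n+1}+n}$ is a DeBruijn string of order $n+1$, and after this string the sequence continues as if $X$ had been the key: the infinite sequence $x_{N+2^{n+1}+n+1}\,x_{N+2^{n+1}+n+2}\dots$ equals $EM_n(X)$.
   Context: All strings are over the alphabet $\{0,1\}$; for a digit $y$, $y' = 1-y$. A DeBruijn string of order $m$ is a binary string of length $2^m+m-1$ that contains every binary string of length $m$ as a (contiguous) substring. Definition of $EM_n(Z)$ for $n\ge 1$ and a finite binary string $Z$: it is the infinite binary sequence $x_1x_2x_3\dots$ generated digit by digit as follows. Suppose $x_1,\dots,x_k$ ($k\ge 0$) have been generated and let $W = Zx_1\cdots x_k$ (concatenation). If $W$ is empty (i.e. $Z$ is empty and $k=0$), put $x_1 = 0$. Otherwise let $\sigma$ be the longest tail (suffix, possibly empty) of $W$ with $|\sigma|\le n$ that also occurs as a substring of $W$ with its last digit removed. Take the latest (rightmost) such earlier occurrence and let $y$ be the digit of $W$ immediately following it; if $\sigma$ is empty, the latest previous occurrence is understood to be just before the last digit of $W$, so $y$ is the last digit of $W$. Then $x_{k+1} = y'$. The sequence $EM_n(Z)$ does not include the seed $Z$. -}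

module Defs where

open import Data.Bool.Base using (Bool; true; false; not; if_then_else_)
open import Data.Bool.Properties using (_≟_)
open import Data.List.Base
  using (List; []; _∷_; _∷ʳ_; length; head; tails; filter; mapMaybe; applyUpTo)
open import Data.List.Relation.Binary.Infix.Heterogeneous using (Infix)
open import Data.Maybe.Base using (Maybe; just; nothing; maybe′; _<∣>_)
open import Data.Nat.Base using (ℕ; zero; suc; _+_; _∸_; _^_)
open import Data.Nat.Properties using (_≤?_)
open import Data.Product.Base using (_×_)
open import Relation.Binary.PropositionalEquality.Core using (_≡_)
open import Relation.Nullary.Decidable.Core using (does)

-- The digits 0 and 1 are false and true; y′ = 1 − y is not y.
BinString : Set
BinString = List Bool

Substring : BinString → BinString → Set
Substring = Infix _≡_

IsDeBruijn : ℕ → BinString → Set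
IsDeBruijn m X =
  length X ≡ 2 ^ m + m ∸ 1 ×
  (∀ (w : BinString) → length w ≡ m → Substring w X)

-- digitAfterPrefix σ W is just y when W begins with σ y.
digitAfterPrefix : BinString → BinString → Maybe Bool
digitAfterPrefix []      []      = nothing
digitAfterPrefix []      (y ∷ _) = just y
digitAfterPrefix (_ ∷ _) []      = nothing
digitAfterPrefix (s ∷ σ) (w ∷ W) =
  if does (s ≟ w) then digitAfterPrefix σ W else nothing

-- The digit of W following the rightmost occurrence of σ in W with its last
-- digit removed, or nothing if there is no such occurrence: an occurrence of
-- σ in W avoids the last digit exactly when some digit of W follows it.  For
-- empty σ and nonempty W this is the last digit of W.
digitAfterLatest : BinString → BinString → Maybe Bool
digitAfterLatest σ []      = digitAfterPrefix σ []
digitAfterLatest σ (w ∷ W) =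
  digitAfterLatest σ W <∣> digitAfterPrefix σ (w ∷ W)

-- The digit generated after W.  The library function tails lists the suffixes
-- of W from the longest to the shortest, so the head below comes from the
-- longest suffix of length at most n that has an earlier occurrence.  No
-- suffix has one only if W is empty; then the digit is 0.
nextDigit : ℕ → BinString → Bool
nextDigit n W =
  maybe′ not false
    (head (mapMaybe (λ σ → digitAfterLatest σ W)
                    (filter (λ σ → length σ ≤? n) (tails W))))

-- history n Z k is Z x₁ ⋯ xₖ.
history : ℕ → BinString → ℕ → BinString
history n Z zero    = Z
history n Z (suc k) = history n Z k ∷ʳ nextDigit n (history n Z k)

-- Sequences are indexed from 0: EM n Z k is x₍ₖ₊₁₎.
EM : ℕ → BinString → ℕ → Bool
EM n Z k = nextDigit n (history n Z k)

-- block x N L is x_{N+1} ⋯ x_{N+L} in indexing from 1.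
block : (ℕ → Bool) → ℕ → ℕ → BinString
block x N L = applyUpTo (λ i → x (N + i)) L

{-# OPTIONS --safe #-}

-- Once a word u of length n has occurred in x = EM n Z, the digit after each
-- further occurrence of u is the opposite of the digit after the previous one:
-- x is a rotor-router walk on the de Bruijn graph, whose vertices are the words
-- of length n and whose edges are the words of length n + 1.
--
-- From any time on, no edge is traversed more often than the first one, f,
-- because each vertex has two entrances and two alternating exits.  The same
-- balance shows that no edge falls behind f by more than a constant.  Hence f
-- cannot keep returning faster than every M = 2 ^ (n + 1) steps: after a long
-- time t each of the M edges would have been traversed more than t / M times.
-- So at some time N the first edge does not recur within M steps, which leaves M
-- pairwise distinct edges, that is, all of them.  Afterwards the latest earlier
-- occurrence of the last n digits always lies in the window found or after it.
module Submission where

open import Defs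
open import Data.Bool.Base using (Bool; true; false; not; _∧_)
open import Data.Bool.Properties using (_≟_; not-involutive; ∧-assoc; ∧-zeroʳ; ¬-not)
open import Data.List.Base
  using ([]; _∷_; _∷ʳ_; _++_; length; head; tails; filter; mapMaybe; applyUpTo;
         initLast; _∷ʳ′_; take; drop; replicate; module Tails)
open import Data.List.Properties
  using (length-++; length-drop; length-replicate; take++drop≡id; ++-assoc; ++-identityʳ;
         ∷ʳ-++; filter-accept; filter-reject)
open import Data.List.Relation.Binary.Infix.Heterogeneous using (MkView; fromView)
import Data.List.Relation.Binary.Pointwise as Pointwise
open import Data.Maybe.Base using (just; nothing; maybe′)
open import Data.Nat.Base
  using (ℕ; zero; suc; _+_; _*_; _∸_; _^_; _≤_; _<_; z≤n; s≤s; s≤s⁻¹)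
open import Data.Nat.Properties
  using (+-comm; +-assoc; +-suc; +-identityʳ; *-comm; *-distribˡ-+; +-mono-≤; +-monoˡ-≤;
         +-monoʳ-≤; *-monoʳ-≤; +-cancelʳ-≤; +-cancelˡ-≤; suc-injective; m≤n+m∸n;
         m≤n+o⇒m∸n≤o; m≤n⇒∃[o]m+o≡n; m∸[m∸n]≡n; ≤-refl; ≤-trans; ≤-reflexive; <-irrefl;
         <-trans; n≤1+n; n<1+n; m≤n+m; m≤m+n; m<m+n; m≤n⇒m<n∨m≡n; _≤?_; ≰⇒>;
         module ≤-Reasoning)
open import Data.Nat.Tactic.RingSolver using (solve-∀)
open import Data.Product.Base using (_×_; _,_; ∃-syntax)
open import Data.Sum.Base using (_⊎_; inj₁; inj₂)
open import Relation.Binary.PropositionalEquality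
  using (_≡_; _≢_; refl; sym; trans; cong; cong₂; subst; module ≡-Reasoning)
open import Relation.Nullary using (yes; no; does; contradiction)
open import Relation.Nullary.Decidable using (dec-true; dec-false)

-- Counting times in a half-open interval

indicator : Bool → ℕ
indicator false = 0
indicator true  = 1

indicator≤1 : ∀ b → indicator b ≤ 1
indicator≤1 false = z≤n
indicator≤1 true  = ≤-refl

count : (ℕ → Bool) → ℕ → ℕ → ℕ
count P s zero    = 0
count P s (suc L) = indicator (P s) + count P (suc s) L

count-suc : ∀ P s L → count P s (suc L) ≡ count P s L + indicator (P (s + L))
count-suc P s zero    rewrite +-identityʳ s = +-identityʳ _
count-suc P s (suc L) = begin
  indicator (P s) + count P (suc s) (suc L)
    ≡⟨ cong (indicator (P s) +_) (count-suc P (suc s) L) ⟩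
  indicator (P s) + (count P (suc s) L + indicator (P (suc s + L)))
    ≡⟨ sym (+-assoc (indicator (P s)) _ _) ⟩
  count P s (suc L) + indicator (P (suc s + L))
    ≡⟨ cong (λ t → count P s (suc L) + indicator (P t)) (sym (+-suc s L)) ⟩
  count P s (suc L) + indicator (P (s + suc L)) ∎
  where open ≡-Reasoning

count-split : ∀ {P Q R} →
  (∀ i → indicator (P i) + indicator (Q i) ≡ indicator (R i)) →
  ∀ s L → count P s L + count Q s L ≡ count R s L
count-split         h s zero    = refl
count-split {P} {Q} h s (suc L) =
  trans (interchange (indicator (P s)) _ (indicator (Q s)) _)
        (cong₂ _+_ (h s) (count-split h (suc s) L))
  where
  interchange : ∀ a b c d → (a + b) + (c + d) ≡ (a + c) + (b + d)
  interchange = solve-∀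

count-shift : ∀ P s L → count (λ i → P (suc i)) s L ≡ count P (suc s) L
count-shift P s zero    = refl
count-shift P s (suc L) = cong (indicator (P (suc s)) +_) (count-shift P (suc s) L)

count>0⇒∃ : ∀ P s L → 1 ≤ count P s L → ∃[ i ] (i < L × P (s + i) ≡ true)
count>0⇒∃ P s (suc L) h with P s in eq
... | true  = 0 , s≤s z≤n , trans (cong P (+-identityʳ s)) eq
... | false with i , i<L , p ← count>0⇒∃ P (suc s) L h =
  suc i , s≤s i<L , trans (cong P (+-suc s i)) p

count-mono : ∀ P s L k → count P s L ≤ count P s (L + k)
count-mono P s zero    k = z≤n
count-mono P s (suc L) k = +-monoʳ-≤ (indicator (P s)) (count-mono P (suc s) L k)

-- Windows of a sequence and occurrences of words

-- The recursion moves the starting point, unlike in `block`, so that splitting off the first digit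
-- holds by computation.
window : (ℕ → Bool) → ℕ → ℕ → BinString
window x s zero    = []
window x s (suc L) = x s ∷ window x (suc s) L

length-window : ∀ x s L → length (window x s L) ≡ L
length-window x s zero    = refl
length-window x s (suc L) = cong suc (length-window x (suc s) L)

window-+ : ∀ x s K L → window x s (K + L) ≡ window x s K ++ window x (s + K) L
window-+ x s zero    L = cong (λ t → window x t L) (sym (+-identityʳ s))
window-+ x s (suc K) L = cong (x s ∷_)
  (trans (window-+ x (suc s) K L)
         (cong (λ t → window x (suc s) K ++ window x t L) (sym (+-suc s K))))

window-∷ʳ : ∀ x s L → window x s L ∷ʳ x (s + L) ≡ window x s (suc L)
window-∷ʳ x s L = trans (sym (window-+ x s L 1)) (cong (window x s) (+-comm L 1))

block≡window : ∀ x N L → block x N L ≡ window x N L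
block≡window x N zero    = refl
block≡window x N (suc L) =
  cong₂ _∷_ (cong x (+-identityʳ N)) (trans (shift L (λ i → cong x (+-suc N i))) (block≡window x (suc N) L))
  where
  shift : ∀ {f g : ℕ → Bool} L → (∀ i → f i ≡ g i) → applyUpTo f L ≡ applyUpTo g L
  shift zero    f≗g = refl
  shift (suc L) f≗g = cong₂ _∷_ (f≗g 0) (shift L (λ i → f≗g (suc i)))

occursAt : (ℕ → Bool) → BinString → ℕ → Bool
occursAt x []      i = true
occursAt x (b ∷ p) i = does (b ≟ x i) ∧ occursAt x p (suc i)

occursAt-window : ∀ x s L → occursAt x (window x s L) s ≡ true
occursAt-window x s zero    = refl
occursAt-window x s (suc L) =
  cong₂ _∧_ (dec-true (x s ≟ x s) refl) (occursAt-window x (suc s) L)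

occursAt⇒window : ∀ x w s → occursAt x w s ≡ true → w ≡ window x s (length w)
occursAt⇒window x []      s h = refl
occursAt⇒window x (b ∷ w) s h with b ≟ x s
... | yes refl = cong (b ∷_) (occursAt⇒window x w (suc s) h)

occursAt-∷ʳ : ∀ x u c i →
  occursAt x (u ∷ʳ c) i ≡ occursAt x u i ∧ does (c ≟ x (i + length u))
occursAt-∷ʳ x []      c i rewrite +-identityʳ i with does (c ≟ x i)
... | true  = refl
... | false = refl
occursAt-∷ʳ x (b ∷ u) c i rewrite +-suc i (length u) =
  trans (cong (does (b ≟ x i) ∧_) (occursAt-∷ʳ x u c (suc i)))
        (sym (∧-assoc (does (b ≟ x i)) _ _))

occursAt-∷ʳ⁻ : ∀ x u c i → occursAt x (u ∷ʳ c) i ≡ true →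
  occursAt x u i ≡ true × x (i + length u) ≡ c
occursAt-∷ʳ⁻ x u c i h with occursAt x u i | c ≟ x (i + length u) | occursAt-∷ʳ x u c i
... | true  | yes refl | _  = refl , refl
... | true  | no _     | eq = contradiction (trans (sym h) eq) λ ()
... | false | _        | eq = contradiction (trans (sym h) eq) λ ()

occursAt-∷ʳ⁺ : ∀ x u i → occursAt x u i ≡ true → occursAt x (u ∷ʳ x (i + length u)) i ≡ true
occursAt-∷ʳ⁺ x u i h = trans (occursAt-∷ʳ x u (x (i + length u)) i)
  (cong₂ _∧_ h (dec-true (x (i + length u) ≟ x (i + length u)) refl))

occurrences : (ℕ → Bool) → BinString → ℕ → ℕ → ℕ
occurrences x w = count (occursAt x w)

occurrences-[] : ∀ x s L → occurrences x [] s L ≡ L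
occurrences-[] x s zero    = refl
occurrences-[] x s (suc L) = cong suc (occurrences-[] x (suc s) L)

-- Each visit to the vertex `u` is followed by exactly one digit, so it leaves by exactly one of the
-- two exits.
occurrences-∷ʳ : ∀ x u c s L →
  occurrences x (u ∷ʳ c) s L + occurrences x (u ∷ʳ not c) s L ≡ occurrences x u s L
occurrences-∷ʳ x u c = count-split pointwise
  where
  digits : ∀ m c b → indicator (m ∧ does (c ≟ b)) + indicator (m ∧ does (not c ≟ b)) ≡ indicator m
  digits false c     b     = refl
  digits true  false false = refl
  digits true  false true  = refl
  digits true  true  false = refl
  digits true  true  true  = refl
  pointwise : ∀ i →
    indicator (occursAt x (u ∷ʳ c) i) + indicator (occursAt x (u ∷ʳ not c) i)
      ≡ indicator (occursAt x u i)
  pointwise i rewrite occursAt-∷ʳ x u c i | occursAt-∷ʳ x u (not c) i = digits _ c _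

-- Each visit to `u` at a time i + 1 comes through one of the two entrances, which is traversed at
-- time i; hence the shift of the interval.
occurrences-∷ : ∀ x b u s L →
  occurrences x (b ∷ u) s L + occurrences x (not b ∷ u) s L ≡ occurrences x u (suc s) L
occurrences-∷ x b u s L = trans (count-split pointwise s L) (count-shift (occursAt x u) s L)
  where
  digits : ∀ m b c → indicator (does (b ≟ c) ∧ m) + indicator (does (not b ≟ c) ∧ m) ≡ indicator m
  digits m false false = +-identityʳ _
  digits m false true  = refl
  digits m true  false = refl
  digits m true  true  = +-identityʳ _
  pointwise : ∀ i →
    indicator (occursAt x (b ∷ u) i) + indicator (occursAt x (not b ∷ u) i)
      ≡ indicator (occursAt x u (suc i))
  pointwise i = digits _ b (x i)

-- Summing over the binary tree of extensions of a word

extensions-lower : ∀ x s L X ℓ p →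
  (∀ w → length w ≡ ℓ → X ≤ occurrences x (p ++ w) s L) →
  2 ^ ℓ * X ≤ occurrences x p s L
extensions-lower x s L X zero p h =
  subst (λ q → X + 0 ≤ occurrences x q s L) (++-identityʳ p)
        (≤-trans (≤-reflexive (+-identityʳ X)) (h [] refl))
extensions-lower x s L X (suc ℓ) p h = begin
  2 ^ suc ℓ * X                ≡⟨ double (2 ^ ℓ) X ⟩
  2 ^ ℓ * X + 2 ^ ℓ * X        ≤⟨ +-mono-≤ (half false) (half true) ⟩
  occurrences x (p ∷ʳ false) s L + occurrences x (p ∷ʳ true) s L
                               ≡⟨ occurrences-∷ʳ x p false s L ⟩
  occurrences x p s L          ∎
  where
  open ≤-Reasoning
  double : ∀ a b → (2 * a) * b ≡ a * b + a * b
  double = solve-∀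
  half : ∀ b → 2 ^ ℓ * X ≤ occurrences x (p ∷ʳ b) s L
  half b = extensions-lower x s L X ℓ (p ∷ʳ b) λ w eq →
    subst (λ q → X ≤ occurrences x q s L) (sym (∷ʳ-++ p b w)) (h (b ∷ w) (cong suc eq))

extensions-upper : ∀ x s L ℓ p →
  (∀ w → length w ≡ ℓ → occurrences x (p ++ w) s L ≤ 1) →
  occurrences x p s L ≤ 2 ^ ℓ
extensions-upper x s L zero p h =
  subst (λ q → occurrences x q s L ≤ 1) (++-identityʳ p) (h [] refl)
extensions-upper x s L (suc ℓ) p h = begin
  occurrences x p s L          ≡⟨ occurrences-∷ʳ x p false s L ⟨
  occurrences x (p ∷ʳ false) s L + occurrences x (p ∷ʳ true) s L
                               ≤⟨ +-mono-≤ (half false) (half true) ⟩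
  2 ^ ℓ + 2 ^ ℓ                ≡⟨ cong (2 ^ ℓ +_) (+-identityʳ (2 ^ ℓ)) ⟨
  2 ^ suc ℓ                    ∎
  where
  open ≤-Reasoning
  half : ∀ b → occurrences x (p ∷ʳ b) s L ≤ 2 ^ ℓ
  half b = extensions-upper x s L ℓ (p ∷ʳ b) λ w eq →
    subst (λ q → occurrences x q s L ≤ 1) (sym (∷ʳ-++ p b w)) (h (b ∷ w) (cong suc eq))

-- Pigeonhole: the tree below `p` has 2 ^ ℓ leaves, each met at most once. In the induction, the
-- sibling subtree absorbs at most half of the occurrences, so the other half is full as well.
extensions-all : ∀ x s L ℓ p →
  (∀ w → length w ≡ ℓ → occurrences x (p ++ w) s L ≤ 1) →
  2 ^ ℓ ≤ occurrences x p s L →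
  ∀ w → length w ≡ ℓ → 1 ≤ occurrences x (p ++ w) s L
extensions-all x s L zero p h full [] refl =
  subst (λ q → 1 ≤ occurrences x q s L) (sym (++-identityʳ p)) full
extensions-all x s L (suc ℓ) p h full (b ∷ w) eq =
  subst (λ q → 1 ≤ occurrences x q s L) (∷ʳ-++ p b w)
    (extensions-all x s L ℓ (p ∷ʳ b) (h′ b) full′ w (suc-injective eq))
  where
  open ≤-Reasoning
  h′ : ∀ c w → length w ≡ ℓ → occurrences x ((p ∷ʳ c) ++ w) s L ≤ 1
  h′ c w eq = subst (λ q → occurrences x q s L ≤ 1) (sym (∷ʳ-++ p c w)) (h (c ∷ w) (cong suc eq))
  full′ : 2 ^ ℓ ≤ occurrences x (p ∷ʳ b) s L
  full′ = +-cancelʳ-≤ (2 ^ ℓ) _ _ (begin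
    2 ^ ℓ + 2 ^ ℓ              ≡⟨ cong (2 ^ ℓ +_) (+-identityʳ (2 ^ ℓ)) ⟨
    2 ^ suc ℓ                  ≤⟨ full ⟩
    occurrences x p s L        ≡⟨ occurrences-∷ʳ x p b s L ⟨
    occurrences x (p ∷ʳ b) s L + occurrences x (p ∷ʳ not b) s L
      ≤⟨ +-monoʳ-≤ _ (extensions-upper x s L ℓ (p ∷ʳ not b) (h′ (not b))) ⟩
    occurrences x (p ∷ʳ b) s L + 2 ^ ℓ ∎)

-- Rotor walks and their alternating exits

-- Here `i` and `j` start two consecutive visits to `u`. The first exit from each vertex is left
-- free, as the initial state of its rotor.
IsRotor : ℕ → (ℕ → Bool) → Set
IsRotor n x = ∀ u i j → length u ≡ n → i < j →
  occursAt x u i ≡ true → occursAt x u j ≡ true →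
  (∀ l → i < l → l < j → occursAt x u l ≡ false) →
  x (j + n) ≡ not (x (i + n))

not≢ : ∀ a → not a ≢ a
not≢ false ()
not≢ true  ()

module Exits {x : ℕ → Bool} {u : BinString} (rotor : IsRotor (length u) x) where

  exit : ℕ → Bool
  exit t = x (t + length u)

  exits : Bool → ℕ → ℕ → ℕ
  exits c = occurrences x (u ∷ʳ c)

  -- The state of the rotor at `u` just before time `t`.
  LastExit : ℕ → Bool → Set
  LastExit t d = ∃[ i ] (i < t × occursAt x u i ≡ true ×
    (∀ l → i < l → l < t → occursAt x u l ≡ false) × exit i ≡ d)

  lastExit-here : ∀ t {d} → occursAt x u t ≡ true → exit t ≡ d → LastExit (suc t) d
  lastExit-here t m e =
    t , n<1+n t , m , (λ l t<l l<st → contradiction (≤-trans t<l (s≤s⁻¹ l<st)) (<-irrefl refl)) , e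

  lastExit-suc : ∀ {t d} → occursAt x u t ≡ false → LastExit t d → LastExit (suc t) d
  lastExit-suc {t} ¬m (i , i<t , m , none , e) = i , <-trans i<t (n<1+n t) , m , none′ , e
    where
    none′ : ∀ l → i < l → l < suc t → occursAt x u l ≡ false
    none′ l i<l l<st with m≤n⇒m<n∨m≡n (s≤s⁻¹ l<st)
    ... | inj₁ l<t  = none l i<l l<t
    ... | inj₂ refl = ¬m

  nextExit : ∀ {t d} → LastExit t d → occursAt x u t ≡ true → exit t ≡ not d
  nextExit {t} (i , i<t , m , none , refl) m′ = rotor u i t refl i<t m m′ none

  -- The exits from u during [s , s + L) when the first of them was a.
  Alternating : ℕ → ℕ → Bool → Set
  Alternating s L a =
    (LastExit (s + L) a × exits a s L ≡ suc (exits (not a) s L)) ⊎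
    (LastExit (s + L) (not a) × exits a s L ≡ exits (not a) s L)

  exits-idle : ∀ s L c → occursAt x u (s + L) ≡ false → exits c s (suc L) ≡ exits c s L
  exits-idle s L c ¬m
    rewrite count-suc (occursAt x (u ∷ʳ c)) s L | occursAt-∷ʳ x u c (s + L) | ¬m = +-identityʳ _

  exits-taken : ∀ s L {c} → occursAt x u (s + L) ≡ true → exit (s + L) ≡ c →
    exits c s (suc L) ≡ suc (exits c s L)
  exits-taken s L {c} m e
    rewrite count-suc (occursAt x (u ∷ʳ c)) s L | occursAt-∷ʳ x u c (s + L) | m | e
          | dec-true (c ≟ c) refl = +-comm _ 1

  exits-untaken : ∀ s L {c} → exit (s + L) ≢ c → exits c s (suc L) ≡ exits c s L
  exits-untaken s L {c} e
    rewrite count-suc (occursAt x (u ∷ʳ c)) s L | occursAt-∷ʳ x u c (s + L)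
          | dec-false (c ≟ exit (s + L)) (λ c≡ → e (sym c≡))
          | ∧-zeroʳ (occursAt x u (s + L)) = +-identityʳ _

  alternating-start : ∀ s L → (∀ c → exits c s L ≡ 0) → occursAt x u (s + L) ≡ true →
    Alternating s (suc L) (exit (s + L))
  alternating-start s L none m = inj₁
    ( subst (λ t → LastExit t a) (sym (+-suc s L)) (lastExit-here (s + L) m refl)
    , (begin
        exits a s (suc L)              ≡⟨ exits-taken s L m refl ⟩
        suc (exits a s L)              ≡⟨ cong suc (trans (none a) (sym (none (not a)))) ⟩
        suc (exits (not a) s L)        ≡⟨ cong suc (exits-untaken s L (λ e → not≢ a (sym e))) ⟨
        suc (exits (not a) s (suc L))  ∎))
    where
    open ≡-Reasoning
    a = exit (s + L)

  alternating-suc : ∀ s L {a} → Alternating s L a → Alternating s (suc L) a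
  alternating-suc s L {a} alt with occursAt x u (s + L) in m
  alternating-suc s L {a} (inj₁ (last , odd)) | false = inj₁
    ( subst (λ t → LastExit t a) (sym (+-suc s L)) (lastExit-suc m last)
    , trans (exits-idle s L a m) (trans odd (cong suc (sym (exits-idle s L (not a) m)))))
  alternating-suc s L {a} (inj₂ (last , even)) | false = inj₂
    ( subst (λ t → LastExit t (not a)) (sym (+-suc s L)) (lastExit-suc m last)
    , trans (exits-idle s L a m) (trans even (sym (exits-idle s L (not a) m))))
  alternating-suc s L {a} (inj₁ (last , odd)) | true = inj₂
    ( subst (λ t → LastExit t (not a)) (sym (+-suc s L)) (lastExit-here (s + L) m e)
    , trans (exits-untaken s L (λ e′ → not≢ a (trans (sym e) e′)))
        (trans odd (sym (exits-taken s L m e))))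
    where
    e = nextExit last m
  alternating-suc s L {a} (inj₂ (last , even)) | true = inj₁
    ( subst (λ t → LastExit t a) (sym (+-suc s L)) (lastExit-here (s + L) m e)
    , trans (exits-taken s L m e)
        (cong suc (trans even (sym (exits-untaken s L (λ e′ → not≢ a (trans (sym e′) e)))))))
    where
    e = trans (nextExit last m) (not-involutive a)

  unused∨alternating : ∀ s L → (∀ c → exits c s L ≡ 0) ⊎ ∃[ a ] Alternating s L a
  unused∨alternating s zero = inj₁ λ c → refl
  unused∨alternating s (suc L) with unused∨alternating s L
  ... | inj₂ (a , alt) = inj₂ (a , alternating-suc s L alt)
  ... | inj₁ none with occursAt x u (s + L) in m
  ...   | true  = inj₂ (_ , alternating-start s L none m)
  ...   | false = inj₁ λ c → trans (exits-idle s L c m) (none c)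

  alternating-from-start : ∀ s L → occursAt x u s ≡ true → Alternating s (suc L) (exit s)
  alternating-from-start s zero m =
    subst (λ t → Alternating s 1 (exit t)) (+-identityʳ s)
      (alternating-start s 0 (λ c → refl) (trans (cong (occursAt x u) (+-identityʳ s)) m))
  alternating-from-start s (suc L) m = alternating-suc s (suc L) (alternating-from-start s L m)

  exits-balanced : ∀ s L c → exits c s L ≤ suc (exits (not c) s L)
  exits-balanced s L c with unused∨alternating s L
  ... | inj₁ none = ≤-trans (≤-reflexive (none c)) z≤n
  ... | inj₂ (a , alt) with a ≟ c
  exits-balanced s L c | inj₂ (a , inj₁ (_ , odd))  | yes refl = ≤-reflexive odd
  exits-balanced s L c | inj₂ (a , inj₂ (_ , even)) | yes refl =
    ≤-trans (≤-reflexive even) (n≤1+n _)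
  ... | no a≢c with ¬-not a≢c
  exits-balanced s L c | inj₂ (a , inj₁ (_ , odd))  | no a≢c | refl
    rewrite not-involutive c = ≤-trans (n≤1+n _) (≤-trans (≤-reflexive (sym odd)) (n≤1+n _))
  exits-balanced s L c | inj₂ (a , inj₂ (_ , even)) | no a≢c | refl
    rewrite not-involutive c = ≤-trans (≤-reflexive (sym even)) (n≤1+n _)

  -- If `c` is about to be taken, the previous exit in the interval, if any, was the opposite one,
  -- so `c` is not ahead.
  exits-minimal : ∀ s L {c} → occursAt x u (s + L) ≡ true → exit (s + L) ≡ c →
    exits c s L ≤ exits (not c) s L
  exits-minimal s L m e with unused∨alternating s L
  ... | inj₁ none = ≤-trans (≤-reflexive (none _)) z≤n
  exits-minimal s L m e | inj₂ (a , inj₁ (last , odd))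
    with refl ← trans (sym e) (nextExit last m)
    rewrite not-involutive a = ≤-trans (n≤1+n _) (≤-reflexive (sym odd))
  exits-minimal s L m e | inj₂ (a , inj₂ (last , even))
    with refl ← trans (sym e) (trans (nextExit last m) (not-involutive a)) = ≤-reflexive even

  -- Were the two exits level, the rotor would be about to repeat the exit taken at `s`; since the
  -- other one comes next, the first is one ahead.
  secondExit-less : ∀ s L → occursAt x u s ≡ true →
    occursAt x u (s + suc L) ≡ true → exit (s + suc L) ≢ exit s →
    exits (not (exit s)) s (suc L) < exits (exit s) s (suc L)
  secondExit-less s L m m′ ≢first with alternating-from-start s L m
  ... | inj₁ (last , odd)  = ≤-reflexive (sym odd)
  ... | inj₂ (last , even) =
    contradiction (trans (nextExit last m′) (not-involutive _)) ≢first

-- No edge overtakes the first one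

-- If an edge e = uc were about to overtake the starting edge f, both exits of u
-- would have been used at least as often as f; but u has been entered at most
-- twice as often as f, and, unless the walk starts at u, once more than left.  If
-- it starts at u, then e is the second exit to be used and stays behind f.
overtaking-impossible : ∀ {x} u c s L → IsRotor (length u) x →
  let F = occurrences x (window x s (suc (length u))) s L in
  (∀ w → length w ≡ suc (length u) → occurrences x w s L ≤ F) →
  occursAt x (u ∷ʳ c) (s + L) ≡ true → occursAt x (u ∷ʳ c) s ≡ false →
  occurrences x (u ∷ʳ c) s L < F
overtaking-impossible {x} u c s L rotor dominated now ¬start
  with occursAt x u s in at-start | occursAt-∷ʳ⁻ x u c (s + L) now
... | false | (m , e) = ≰⇒> λ F≤ → <-irrefl refl (begin-strict
  F + F                                        ≤⟨ +-mono-≤ F≤ (≤-trans F≤ (exits-minimal s L m e)) ⟩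
  exits c s L + exits (not c) s L              ≡⟨ occurrences-∷ʳ x u c s L ⟩
  occurrences x u s L                          <⟨ n<1+n _ ⟩
  suc (occurrences x u s L)                    ≡⟨ +-comm 1 _ ⟩
  occurrences x u s L + 1                      ≡⟨ cong (λ b → occurrences x u s L + indicator b) m ⟨
  occurrences x u s L + indicator (occursAt x u (s + L))
                                               ≡⟨ count-suc (occursAt x u) s L ⟨
  occurrences x u s (suc L)                    ≡⟨ cong (λ b → indicator b + occurrences x u (suc s) L) at-start ⟩
  occurrences x u (suc s) L                    ≡⟨ occurrences-∷ x true u s L ⟨
  occurrences x (true ∷ u) s L + occurrences x (false ∷ u) s L
                                               ≤⟨ +-mono-≤ (dominated (true ∷ u) refl) (dominated (false ∷ u) refl) ⟩
  F + F                                        ∎)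
  where
  open ≤-Reasoning
  open Exits {u = u} rotor
  F = occurrences x (window x s (suc (length u))) s L
... | true | (m , e) = second L now m e
  where
  open ≤-Reasoning
  open Exits {u = u} rotor
  f : u ∷ʳ exit s ≡ window x s (suc (length u))
  f = trans (cong (_∷ʳ exit s) (occursAt⇒window x u s at-start)) (window-∷ʳ x s (length u))
  c≢ : c ≢ exit s
  c≢ refl = contradiction (trans (sym ¬start) (occursAt-∷ʳ⁺ x u s at-start)) λ ()
  second : ∀ L → occursAt x (u ∷ʳ c) (s + L) ≡ true → occursAt x u (s + L) ≡ true →
    exit (s + L) ≡ c → exits c s L < occurrences x (window x s (suc (length u))) s L
  second zero now _ _ = contradiction
    (trans (sym ¬start) (trans (cong (occursAt x (u ∷ʳ c)) (sym (+-identityʳ s))) now)) λ ()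
  second (suc L) _ m e = begin-strict
    exits c s (suc L)              ≡⟨ cong (λ b → exits b s (suc L)) (¬-not c≢) ⟩
    exits (not (exit s)) s (suc L)
      <⟨ secondExit-less s L at-start m (λ e′ → c≢ (trans (sym e) e′)) ⟩
    exits (exit s) s (suc L)       ≡⟨ cong (λ w → occurrences x w s (suc L)) f ⟩
    occurrences x (window x s (suc (length u))) s (suc L) ∎

-- Induction on `L`: only the edge traversed at time s + L could break the bound. Either it is the
-- first edge, and both counts grow, or it was strictly behind by `overtaking-impossible`, which
-- needs the induction hypothesis for all edges at once.
first-dominates : ∀ {n x} → IsRotor n x → ∀ s L w → length w ≡ suc n →
  occurrences x w s L ≤ occurrences x (window x s (suc n)) s L
first-dominates rotor s zero w eq = z≤n
first-dominates {n} {x} rotor s (suc L) w eq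
  rewrite count-suc (occursAt x w) s L | count-suc (occursAt x (window x s (suc n))) s L
  with occursAt x w (s + L) in now
... | false = ≤-trans (≤-reflexive (+-identityʳ _))
                (≤-trans (first-dominates rotor s L w eq) (m≤m+n _ _))
... | true with occursAt x w s in start
...   | true = ≤-reflexive (cong₂ _+_ (cong (λ v → occurrences x v s L) w≡f)
                 (cong indicator (trans (sym now) (cong (λ v → occursAt x v (s + L)) w≡f))))
  where
  w≡f : w ≡ window x s (suc n)
  w≡f = trans (occursAt⇒window x w s start) (cong (window x s) eq)
...   | false with initLast w
...     | u ∷ʳ′ c with refl ← suc-injective (trans (sym eq) (trans (length-++ u) (+-comm (length u) 1))) =
  ≤-trans (≤-reflexive (+-comm _ 1))
    (≤-trans (overtaking-impossible u c s L rotor (first-dominates rotor s L) now start)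
             (m≤m+n _ _))

-- No edge falls far behind the first one

-- One exit of `u` lags by at most k, hence the other by at most k + 1, so `u` is left at least 2F -
-- 2k - 1 times and entered at least 2F - 2k - 2 times. The other entrance accounts for at most F of
-- these.
predecessor-bound : ∀ {x} u → IsRotor (length u) x → ∀ s L k c b →
  let F = occurrences x (window x s (suc (length u))) s L in
  F ≤ occurrences x (u ∷ʳ c) s L + k →
  F ≤ occurrences x (b ∷ u) s L + (k + k + 2)
predecessor-bound {x} u rotor s L k c b F≤ = +-cancelʳ-≤ F _ _ (begin
  F + F                                  ≤⟨ +-mono-≤ F≤ (≤-trans F≤ (+-monoˡ-≤ k (exits-balanced s L c))) ⟩
  (Nc + k) + (suc Nc̄ + k)                ≡⟨ regroup Nc Nc̄ k ⟩
  (Nc + Nc̄) + (k + k + 1)                ≡⟨ cong (_+ (k + k + 1)) (occurrences-∷ʳ x u c s L) ⟩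
  occurrences x u s L + (k + k + 1)      ≤⟨ +-monoˡ-≤ (k + k + 1) left≤entered ⟩
  suc (B + B̄) + (k + k + 1)              ≤⟨ +-monoˡ-≤ (k + k + 1)
                                              (s≤s (+-monoʳ-≤ B (first-dominates rotor s L (not b ∷ u) refl))) ⟩
  suc (B + F) + (k + k + 1)              ≡⟨ regroup′ B F k ⟩
  B + (k + k + 2) + F                    ∎)
  where
  open ≤-Reasoning
  open Exits {u = u} rotor
  F  = occurrences x (window x s (suc (length u))) s L
  Nc = exits c s L
  Nc̄ = exits (not c) s L
  B  = occurrences x (b ∷ u) s L
  B̄  = occurrences x (not b ∷ u) s L
  regroup : ∀ p q k → (p + k) + (suc q + k) ≡ (p + q) + (k + k + 1)
  regroup = solve-∀
  regroup′ : ∀ p q k → suc (p + q) + (k + k + 1) ≡ p + (k + k + 2) + q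
  regroup′ = solve-∀
  -- Entrances traversed in [s , s + L) lead to visits in [s + 1 , s + L]; only a visit at time `s`
  -- itself has no entrance counted.
  left≤entered : occurrences x u s L ≤ suc (B + B̄)
  left≤entered = begin
    occurrences x u s L            ≤⟨ count-mono (occursAt x u) s L 1 ⟩
    occurrences x u s (L + 1)      ≡⟨ cong (occurrences x u s) (+-comm L 1) ⟩
    occurrences x u s (suc L)      ≤⟨ +-monoˡ-≤ (occurrences x u (suc s) L) (indicator≤1 _) ⟩
    suc (occurrences x u (suc s) L) ≡⟨ cong suc (occurrences-∷ x b u s L) ⟨
    suc (B + B̄)                    ∎

-- The value is 2 ^ (j + 1) - 2; what matters is that it does not depend on the length of the
-- interval.
discrepancy : ℕ → ℕ
discrepancy zero    = 0
discrepancy (suc j) = discrepancy j + discrepancy j + 2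

-- Going backwards along edges from the starting edge f, the discrepancy to the
-- number of traversals of f at most doubles, plus two, at each step.
first-bound : ∀ {n x} → IsRotor n x → ∀ s L p j → length p + j ≡ suc n →
  occurrences x (window x s (suc n)) s L
    ≤ occurrences x (p ++ window x s j) s L + discrepancy (length p)
first-bound rotor s L []      j refl = m≤m+n _ _
first-bound {n} {x} rotor s L (b ∷ p) j eq with refl ← trans (sym (suc-injective eq))
    (trans (cong (length p +_) (sym (length-window x s j))) (sym (length-++ p {window x s j}))) =
  predecessor-bound (p ++ window x s j) rotor s L (discrepancy (length p)) (x (s + j)) b
    (subst (λ w → occurrences x (window x s (suc (length (p ++ window x s j)))) s L
                    ≤ occurrences x w s L + discrepancy (length p))
      (trans (cong (p ++_) (sym (window-∷ʳ x s j))) (sym (++-assoc p _ _)))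
      (first-bound rotor s L p (suc j) (trans (+-suc (length p) j) eq)))

-- A stretch of time in which every edge is traversed

-- The interval holds the starting times of words of length n + 1; the digits involved reach n
-- places further.
Covers : ℕ → (ℕ → Bool) → ℕ → Set
Covers n x N = ∀ w → length w ≡ suc n → 1 ≤ occurrences x w N (2 ^ suc n)

Returns : ℕ → (ℕ → Bool) → ℕ → Set
Returns n x s =
  ∃[ i ] (suc i < 2 ^ suc n × occursAt x (window x s (suc n)) (s + suc i) ≡ true)

count>1⇒∃ : ∀ P s L → 2 ≤ count P s L → ∃[ i ] (suc i < L × P (s + suc i) ≡ true)
count>1⇒∃ P s (suc L) h with i , i<L , p ← count>0⇒∃ P (suc s) L (+-cancelˡ-≤ 1 _ _ (≤-trans h (+-monoˡ-≤ _ (indicator≤1 (P s))))) =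
  i , s≤s i<L , trans (cong P (+-suc s i)) p

-- If the first edge is met only once in 2 ^ (n + 1) steps, then by `first-dominates` no edge is met
-- twice, and the pigeonhole principle leaves none out.
covers∨returns : ∀ {n x} → IsRotor n x → ∀ s → Covers n x s ⊎ Returns n x s
covers∨returns {n} {x} rotor s
  with occurrences x (window x s (suc n)) s (2 ^ suc n) ≤? 1
... | no ≰1  = inj₂ (count>1⇒∃ (occursAt x (window x s (suc n))) s (2 ^ suc n) (≰⇒> ≰1))
... | yes ≤1 = inj₁ (extensions-all x s (2 ^ suc n) (suc n) []
  (λ w eq → ≤-trans (first-dominates rotor s (2 ^ suc n) w eq) ≤1)
  (≤-reflexive (sym (occurrences-[] x s (2 ^ suc n)))))

-- Iterates the alternative at each return: the edge at `t` is again the one at time 0. A return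
-- takes strictly fewer than 2 ^ (n + 1) steps, and the summand `m` in `t + m` records the step
-- saved each time.
fastReturns : ∀ {n x} → IsRotor n x → ∀ m →
  (∃[ N ] Covers n x N) ⊎
  (∃[ t ] (t + m ≤ m * 2 ^ suc n × occursAt x (window x 0 (suc n)) t ≡ true ×
    m ≤ occurrences x (window x 0 (suc n)) 0 t))
fastReturns {n} {x} rotor zero = inj₂ (0 , z≤n , occursAt-window x 0 (suc n) , z≤n)
fastReturns {n} {x} rotor (suc m) with fastReturns rotor m
... | inj₁ covers = inj₁ covers
... | inj₂ (t , t+m≤ , at-t , m≤) with covers∨returns rotor t
...   | inj₁ covers        = inj₁ (t , covers)
...   | inj₂ (i , i< , at) = inj₂ (t + suc i , time , subst (λ w → occursAt x w (t + suc i) ≡ true) same at , often)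
  where
  open ≤-Reasoning
  f = window x 0 (suc n)
  same : window x t (suc n) ≡ f
  same = sym (trans (occursAt⇒window x f t at-t) (cong (window x t) (length-window x 0 (suc n))))
  time : t + suc i + suc m ≤ suc m * 2 ^ suc n
  time = begin
    t + suc i + suc m            ≡⟨ regroup t i m ⟩
    suc (suc i) + (t + m)        ≤⟨ +-mono-≤ i< t+m≤ ⟩
    suc m * 2 ^ suc n            ∎
    where
    regroup : ∀ a b c → a + suc b + suc c ≡ suc (suc b) + (a + c)
    regroup = solve-∀
  often : suc m ≤ occurrences x f 0 (t + suc i)
  often = begin
    suc m                                       ≤⟨ s≤s m≤ ⟩
    suc (occurrences x f 0 t)                   ≡⟨ +-comm 1 _ ⟩
    occurrences x f 0 t + 1                     ≡⟨ cong (λ b → occurrences x f 0 t + indicator b) at-t ⟨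
    occurrences x f 0 t + indicator (occursAt x f t) ≡⟨ count-suc (occursAt x f) 0 t ⟨
    occurrences x f 0 (suc t)                   ≤⟨ count-mono (occursAt x f) 0 (suc t) i ⟩
    occurrences x f 0 (suc t + i)               ≡⟨ cong (occurrences x f 0) (+-suc t i) ⟨
    occurrences x f 0 (t + suc i)               ∎

rotor-covers : ∀ {n x} → IsRotor n x → ∃[ N ] Covers n x N
-- With M edges, each lagging by at most K, m returns take at least M * m - M * K steps, but also at
-- most M * m - m. Any m above M * K gives a contradiction.
rotor-covers {n} {x} rotor with fastReturns rotor (suc (2 ^ suc n * discrepancy (suc n)))
... | inj₁ covers = covers
... | inj₂ (t , t+m≤ , _ , m≤) = contradiction (begin-strict
  M * m                    ≤⟨ *-monoʳ-≤ M (m≤n+m∸n m K) ⟩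
  M * (K + (m ∸ K))        ≡⟨ *-distribˡ-+ M K (m ∸ K) ⟩
  M * K + M * (m ∸ K)      ≤⟨ +-monoʳ-≤ (M * K) (extensions-lower x 0 t (m ∸ K) (suc n) [] often) ⟩
  M * K + occurrences x [] 0 t ≡⟨ cong (M * K +_) (occurrences-[] x 0 t) ⟩
  M * K + t                <⟨ n<1+n _ ⟩
  m + t                    ≡⟨ +-comm m t ⟩
  t + m                    ≤⟨ t+m≤ ⟩
  m * M                    ≡⟨ *-comm m M ⟩
  M * m                    ∎) (<-irrefl refl)
  where
  open ≤-Reasoning
  M = 2 ^ suc n
  K = discrepancy (suc n)
  m = suc (M * K)
  often : ∀ w → length w ≡ suc n → m ∸ K ≤ occurrences x w 0 t
  often w eq = m≤n+o⇒m∸n≤o m K (begin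
    m                                            ≤⟨ m≤ ⟩
    -- Taking all of `w` as the prefix uses the path of n + 1 edges from `w` to the first edge,
    -- through words joining a tail of `w` to a head of that edge.
    occurrences x (window x 0 (suc n)) 0 t       ≤⟨ first-bound rotor 0 t w 0 (trans (+-identityʳ _) eq) ⟩
    occurrences x (w ++ []) 0 t + discrepancy (length w)
      ≡⟨ cong₂ (λ v k → occurrences x v 0 t + discrepancy k) (++-identityʳ w) eq ⟩
    occurrences x w 0 t + K                      ≡⟨ +-comm _ K ⟩
    K + occurrences x w 0 t                      ∎)

-- Evaluating the search for the latest occurrence

digitAfterPrefix-++ : ∀ σ b V → digitAfterPrefix σ (σ ++ b ∷ V) ≡ just b
digitAfterPrefix-++ []      b V = refl
digitAfterPrefix-++ (s ∷ σ) b V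
  rewrite dec-true (s ≟ s) refl = digitAfterPrefix-++ σ b V

digitAfterPrefix-short : ∀ σ W → length W ≤ length σ → digitAfterPrefix σ W ≡ nothing
digitAfterPrefix-short []      []      h = refl
digitAfterPrefix-short (s ∷ σ) []      h = refl
digitAfterPrefix-short (s ∷ σ) (w ∷ W) h with s ≟ w
... | yes _ = digitAfterPrefix-short σ W (s≤s⁻¹ h)
... | no _  = refl

digitAfterPrefix-absent : ∀ x σ s L → occursAt x σ s ≡ false →
  digitAfterPrefix σ (window x s L) ≡ nothing
digitAfterPrefix-absent x (b ∷ σ) s zero    h = refl
digitAfterPrefix-absent x (b ∷ σ) s (suc L) h with b ≟ x s
... | yes _ = digitAfterPrefix-absent x σ (suc s) L h
... | no _  = refl

digitAfterLatest-short : ∀ σ W → length W ≤ length σ → digitAfterLatest σ W ≡ nothing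
digitAfterLatest-short σ []      h = digitAfterPrefix-short σ [] h
digitAfterLatest-short σ (w ∷ W) h
  rewrite digitAfterLatest-short σ W (≤-trans (n≤1+n _) h) = digitAfterPrefix-short σ (w ∷ W) h

-- An occurrence at s + d would end the window with no digit after it, so only earlier starting
-- times need to be excluded.
digitAfterLatest-absent : ∀ x σ s d → (∀ l → s ≤ l → l < s + d → occursAt x σ l ≡ false) →
  digitAfterLatest σ (window x s (d + length σ)) ≡ nothing
digitAfterLatest-absent x σ s zero    h =
  digitAfterLatest-short σ (window x s (length σ)) (≤-reflexive (length-window x s (length σ)))
digitAfterLatest-absent x σ s (suc d) h
  rewrite digitAfterLatest-absent x σ (suc s) d (λ l s<l l< →
            h l (≤-trans (n≤1+n s) s<l) (≤-trans l< (≤-reflexive (sym (+-suc s d))))) =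
  digitAfterPrefix-absent x σ s (suc d + length σ) (h s ≤-refl (m<m+n s (s≤s z≤n)))

-- The search prefers later occurrences, so digits put in front cannot change a successful result.
digitAfterLatest-++ : ∀ σ P W {y} → digitAfterLatest σ W ≡ just y →
  digitAfterLatest σ (P ++ W) ≡ just y
digitAfterLatest-++ σ []      W h = h
digitAfterLatest-++ σ (p ∷ P) W h rewrite digitAfterLatest-++ σ P W h = refl

digitAfterLatest-exists : ∀ σ W {y} → digitAfterPrefix σ W ≡ just y →
  ∃[ z ] digitAfterLatest σ W ≡ just z
digitAfterLatest-exists σ []      h = _ , h
digitAfterLatest-exists σ (w ∷ W) h with digitAfterLatest σ W
... | just z  = z , refl
... | nothing = _ , h

-- The filter removes the suffixes longer than `σ`, so `σ` is tried first and succeeds. In `longest`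
-- the list of suffixes shrinks with `V′` while the searched word stays fixed.
nextDigit-suffix : ∀ n V σ {y} → length σ ≡ n → digitAfterLatest σ (V ++ σ) ≡ just y →
  nextDigit n (V ++ σ) ≡ not y
nextDigit-suffix n V σ {y} len after = cong (maybe′ not false) (longest V)
  where
  open ≤-Reasoning
  short? = λ τ → length τ ≤? n
  longest : ∀ V′ → head (mapMaybe (λ τ → digitAfterLatest τ (V ++ σ))
                          (filter short? (tails (V′ ++ σ)))) ≡ just y
  longest [] rewrite filter-accept short? {σ} {Tails.tail σ} (≤-reflexive len) | after = refl
  longest (v ∷ V′)
    rewrite filter-reject short? {v ∷ V′ ++ σ} {tails (V′ ++ σ)} (λ h → <-irrefl refl (begin-strict
      length σ              ≤⟨ m≤n+m _ (length V′) ⟩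
      length V′ + length σ  ≡⟨ length-++ V′ ⟨
      length (V′ ++ σ)      <⟨ h ⟩
      n                     ≡⟨ len ⟨
      length σ              ∎)) = longest V′

-- The generated sequence is a rotor walk

history≡window : ∀ n Z k → history n Z k ≡ Z ++ window (EM n Z) 0 k
history≡window n Z zero    = sym (++-identityʳ Z)
history≡window n Z (suc k) = begin
  history n Z k ∷ʳ x k              ≡⟨ cong (_∷ʳ x k) (history≡window n Z k) ⟩
  (Z ++ window x 0 k) ∷ʳ x k        ≡⟨ ++-assoc Z _ _ ⟩
  Z ++ (window x 0 k ∷ʳ x k)        ≡⟨ cong (Z ++_) (window-∷ʳ x 0 k) ⟩
  Z ++ window x 0 (suc k)           ∎
  where
  open ≡-Reasoning
  x = EM n Z

history-split : ∀ n Z i L →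
  history n Z (i + L) ≡ (Z ++ window (EM n Z) 0 i) ++ window (EM n Z) i L
history-split n Z i L = trans (history≡window n Z (i + L))
  (trans (cong (Z ++_) (window-+ (EM n Z) 0 i L)) (sym (++-assoc Z _ _)))

EM-isRotor : ∀ n Z → IsRotor n (EM n Z)
EM-isRotor n Z u i j refl i<j at-i at-j none with d , refl ← m≤n⇒∃[o]m+o≡n i<j =
  trans (cong (nextDigit n) history-j)
    (nextDigit-suffix n (Z ++ window x 0 (suc i + d)) u refl (trans (cong (digitAfterLatest u) (trans (sym history-j) history-i))
      (digitAfterLatest-++ u (Z ++ window x 0 i) _ latest)))
  where
  open ≡-Reasoning
  x = EM n Z
  -- The same history is cut in two ways: before its last n digits, to show the suffix `u`, and at
  -- time `i`, to show that the latest earlier occurrence of `u` starts there.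
  history-j : history n Z (suc i + d + n) ≡ (Z ++ window x 0 (suc i + d)) ++ u
  history-j = trans (history-split n Z (suc i + d) n)
    (cong ((Z ++ window x 0 (suc i + d)) ++_) (sym (occursAt⇒window x u (suc i + d) at-j)))
  history-i : history n Z (suc i + d + n) ≡ (Z ++ window x 0 i) ++ window x i (suc d + n)
  history-i = trans (cong (history n Z) (regroup i d n)) (history-split n Z i (suc d + n))
    where
    regroup : ∀ a b c → suc a + b + c ≡ a + (suc b + c)
    regroup = solve-∀
  here : digitAfterPrefix u (window x i (suc d + n)) ≡ just (x (i + n))
  here = begin
    digitAfterPrefix u (window x i (suc d + n))
      ≡⟨ cong (λ k → digitAfterPrefix u (window x i k)) (+-comm (suc d) n) ⟩
    digitAfterPrefix u (window x i (n + suc d))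
      ≡⟨ cong (digitAfterPrefix u) (window-+ x i n (suc d)) ⟩
    digitAfterPrefix u (window x i n ++ window x (i + n) (suc d))
      ≡⟨ cong (λ v → digitAfterPrefix u (v ++ window x (i + n) (suc d))) (occursAt⇒window x u i at-i) ⟨
    digitAfterPrefix u (u ++ x (i + n) ∷ window x (suc (i + n)) d)
      ≡⟨ digitAfterPrefix-++ u _ _ ⟩
    just (x (i + n)) ∎
  latest : digitAfterLatest u (window x i (suc d + n)) ≡ just (x (i + n))
  latest rewrite digitAfterLatest-absent x u (suc i) d none = here

-- Forgetting the digits before a window that contains all words

Contains : BinString → BinString → Set
Contains w X = ∃[ A ] ∃[ B ] X ≡ A ++ w ++ B

contains⇒substring : ∀ {w X} → Contains w X → Substring w X
contains⇒substring (A , B , refl) = fromView (MkView A (Pointwise.refl refl) B)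

covers⇒contains : ∀ {n x N} → Covers n x N → ∀ w → length w ≡ suc n →
  Contains w (window x N (2 ^ suc n + n))
covers⇒contains {n} {x} {N} covers w eq
  with i , i<M , at ← count>0⇒∃ (occursAt x w) N (2 ^ suc n) (covers w eq)
  with r , M≡ ← m≤n⇒∃[o]m+o≡n i<M =
  window x N i , window x (N + i + suc n) r , (begin
    window x N (2 ^ suc n + n)         ≡⟨ cong (λ k → window x N (k + n)) M≡ ⟨
    window x N (suc i + r + n)         ≡⟨ cong (window x N) (regroup i r n) ⟩
    window x N (i + (suc n + r))       ≡⟨ window-+ x N i (suc n + r) ⟩
    window x N i ++ window x (N + i) (suc n + r)
      ≡⟨ cong (window x N i ++_) (window-+ x (N + i) (suc n) r) ⟩
    window x N i ++ window x (N + i) (suc n) ++ window x (N + i + suc n) r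
      ≡⟨ cong (λ v → window x N i ++ v ++ window x (N + i + suc n) r) w≡ ⟨
    window x N i ++ w ++ window x (N + i + suc n) r ∎)
  where
  open ≡-Reasoning
  regroup : ∀ a b c → suc a + b + c ≡ a + (suc c + b)
  regroup = solve-∀
  w≡ : w ≡ window x (N + i) (suc n)
  w≡ = trans (occursAt⇒window x w (N + i) at) (cong (window x (N + i)) eq)

contains⇒length≤ : ∀ {w X} → Contains w X → length w ≤ length X
contains⇒length≤ {w} (A , B , refl) = begin
  length w                          ≤⟨ m≤m+n _ (length B) ⟩
  length w + length B               ≡⟨ length-++ w ⟨
  length (w ++ B)                   ≤⟨ m≤n+m _ (length A) ⟩
  length A + length (w ++ B)        ≡⟨ length-++ A ⟨
  length (A ++ w ++ B)              ∎
  where open ≤-Reasoning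

contains-all⇒length≥ : ∀ {n X} → (∀ w → length w ≡ suc n → Contains w X) → n ≤ length X
contains-all⇒length≥ {n} {X} all = begin
  n                              ≤⟨ n≤1+n n ⟩
  suc n                          ≡⟨ length-replicate (suc n) ⟨
  length w                       ≤⟨ contains⇒length≤ (all w (length-replicate (suc n))) ⟩
  length X                       ∎
  where
  open ≤-Reasoning
  w = replicate (suc n) false

splitSuffix : ∀ n (V : BinString) → n ≤ length V → ∃[ V₁ ] ∃[ σ ] (V ≡ V₁ ++ σ × length σ ≡ n)
splitSuffix n V n≤ = take k V , drop k V , sym (take++drop≡id k V) ,
  trans (length-drop k V) (m∸[m∸n]≡n n≤)
  where
  k = length V ∸ n

-- The last n digits of `X ++ Y` also occur inside `X` with a digit after them, so the search
-- already succeeds there and never reaches `P`.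
nextDigit-forget : ∀ n P X Y → (∀ w → length w ≡ suc n → Contains w X) →
  nextDigit n (P ++ X ++ Y) ≡ nextDigit n (X ++ Y)
nextDigit-forget n P X Y all
  with V , σ , split , len ← splitSuffix n (X ++ Y)
    (≤-trans (contains-all⇒length≥ all) (≤-trans (m≤m+n _ _) (≤-reflexive (sym (length-++ X)))))
  -- The choice of `false` is arbitrary: any digit after `σ` makes the occurrence avoid the last
  -- place.
  with A , B , X≡ ← all (σ ∷ʳ false) (trans (length-++ σ) (trans (+-comm _ 1) (cong suc len)))
  with z , after ← digitAfterLatest-exists σ _ (digitAfterPrefix-++ σ false (B ++ Y)) =
  trans (cong (nextDigit n) (trans (cong (P ++_) split) (sym (++-assoc P V σ))))
    (trans (nextDigit-suffix n (P ++ V) σ len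
             (trans (cong (digitAfterLatest σ) (++-assoc P V σ)) (digitAfterLatest-++ σ P _ afterV)))
      (sym (trans (cong (nextDigit n) split) (nextDigit-suffix n V σ len afterV))))
  where
  open ≡-Reasoning
  afterV : digitAfterLatest σ (V ++ σ) ≡ just z
  afterV = begin
    digitAfterLatest σ (V ++ σ)                       ≡⟨ cong (digitAfterLatest σ) split ⟨
    digitAfterLatest σ (X ++ Y)                       ≡⟨ cong (λ v → digitAfterLatest σ (v ++ Y)) X≡ ⟩
    digitAfterLatest σ ((A ++ (σ ∷ʳ false) ++ B) ++ Y) ≡⟨ cong (digitAfterLatest σ) reassoc ⟩
    digitAfterLatest σ (A ++ σ ++ false ∷ B ++ Y)     ≡⟨ digitAfterLatest-++ σ A _ after ⟩
    just z                                            ∎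
    where
    reassoc : (A ++ (σ ∷ʳ false) ++ B) ++ Y ≡ A ++ σ ++ false ∷ B ++ Y
    reassoc = trans (++-assoc A _ Y) (cong (A ++_)
      (trans (++-assoc (σ ∷ʳ false) B Y) (∷ʳ-++ σ false (B ++ Y))))

nextDigit-history-forget : ∀ n P X → (∀ w → length w ≡ suc n → Contains w X) →
  ∀ i → nextDigit n (P ++ history n X i) ≡ nextDigit n (history n X i)
nextDigit-history-forget n P X all i rewrite history≡window n X i =
  nextDigit-forget n P X (window (EM n X) 0 i) all

-- By induction both histories receive the same next digit, so they keep differing only by the fixed
-- prefix.
history-forget : ∀ n Z N L → let X = window (EM n Z) N L in
  (∀ w → length w ≡ suc n → Contains w X) →
  ∀ i → history n Z (N + L + i) ≡ (Z ++ window (EM n Z) 0 N) ++ history n X i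
history-forget n Z N L all zero = trans (cong (history n Z) (+-identityʳ (N + L))) (history-split n Z N L)
history-forget n Z N L all (suc i) = begin
  history n Z (N + L + suc i)              ≡⟨ cong (history n Z) (+-suc (N + L) i) ⟩
  history n Z (N + L + i) ∷ʳ nextDigit n (history n Z (N + L + i))
    ≡⟨ cong (λ W → W ∷ʳ nextDigit n W) (history-forget n Z N L all i) ⟩
  (P ++ history n X i) ∷ʳ nextDigit n (P ++ history n X i)
    ≡⟨ cong ((P ++ history n X i) ∷ʳ_) (nextDigit-history-forget n P X all i) ⟩
  (P ++ history n X i) ∷ʳ nextDigit n (history n X i)
    ≡⟨ ++-assoc P (history n X i) _ ⟩
  P ++ history n X (suc i)                 ∎
  where
  open ≡-Reasoning
  X = window (EM n Z) N L
  P = Z ++ window (EM n Z) 0 N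

theorem3p1 : ∀ (n : ℕ) → 1 ≤ n → (Z : BinString) →
    ∃[ N ] (IsDeBruijn (n + 1) (block (EM n Z) N (2 ^ (n + 1) + n)) ×
    (∀ (i : ℕ) → EM n Z (N + (2 ^ (n + 1) + n) + i)
    ≡ EM n (block (EM n Z) N (2 ^ (n + 1) + n)) i))
theorem3p1 n _ Z rewrite +-comm n 1 with N , covers ← rotor-covers (EM-isRotor n Z) =
  N , subst Conclusion (sym (block≡window x N ℓ))
    ( ( trans (length-window x N ℓ) (cong (_∸ 1) (sym (+-suc (2 ^ suc n) n)))
      , λ w len → contains⇒substring (covers⇒contains covers w len))
    , λ i → trans (cong (nextDigit n) (history-forget n Z N ℓ (covers⇒contains covers) i))
        (nextDigit-history-forget n (Z ++ window x 0 N) (window x N ℓ) (covers⇒contains covers) i))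
  where
  x = EM n Z
  ℓ = 2 ^ suc n + n
  Conclusion : BinString → Set
  Conclusion X = IsDeBruijn (suc n) X × (∀ i → EM n Z (N + ℓ + i) ≡ EM n X i)
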